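{- Let $\Phi$ be the set of formulas of $NOM$ and let $[\![\cdot]\!]:\Phi\to\mathcal Q$ be an interpretation into an orthomodular lattice $\mathcal Q$. If for all formulas $\phi,\psi$ we have $[\![\phi\wedge\psi]\!]=[\![\phi]\!]\wedge[\![\psi]\!]$, $[\![\phi\rightarrow\psi]\!]=[\![\phi]\!]\rightarrow[\![\psi]\!]$, and $[\![\neg\phi]\!]=\neg[\![\phi]\!]$, then all the rules of inference of $NOM$ are sound in this interpretation.
   Context: The propositional deductive system $NOM$: formulas are built from propositional letters using $\wedge$, $\rightarrow$, $\neg$. Sequents are $\phi_1,\ldots,\phi_n\vdash\psi$ ($n\ge0$) with antecedent a finite ordered sequence. With $\Gamma$ a finite possibly empty sequence of formulas and $\phi,\psi,\chi$ formulas, the rules of $NOM$ are: (assumption) $\Gamma,\phi\vdash\phi$; (cut) $\Gamma\vdash\phi$, $\Gamma,\phi\vdash\psi$ $\Rightarrow$ $\Gamma\vdash\psi$; (paste) $\Gamma\vdash\phi$, $\Gamma\vdash\psi$ $\Rightarrow$ $\Gamma,\phi\vdash\psi$; (compatible exchange) $\Gamma,\phi,\psi\vdash\phi$, $\Gamma,\phi,\psi\vdash\chi$, $\Gamma,\psi,\phi\vdash\psi$ $\Rightarrow$ $\Gamma,\psi,\phi\vdash\chi$; ($\wedge$-intro) $\Gamma\vdash\phi$, $\Gamma\vdash\psi$ $\Rightarrow$ $\Gamma\vdash\phi\wedge\psi$; ($\wedge$-elim) $\Gamma\vdash\phi\wedge\psi$ $\Rightarrow$ $\Gamma\vdash\phi$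 and $\Rightarrow$ $\Gamma\vdash\psi$; ($\rightarrow$-intro) $\Gamma,\phi\vdash\psi$ $\Rightarrow$ $\Gamma\vdash\phi\rightarrow\psi$; ($\rightarrow$-elim) $\Gamma\vdash\phi\rightarrow\psi$ $\Rightarrow$ $\Gamma,\phi\vdash\psi$; (excluded middle) $\Gamma,\phi\vdash\psi$, $\Gamma,\neg\phi\vdash\psi$ $\Rightarrow$ $\Gamma\vdash\psi$; (explosion) $\Gamma\vdash\neg\phi$ $\Rightarrow$ $\Gamma,\phi\vdash\psi$. An orthomodular lattice is a bounded lattice with an order-reversing involution $\neg$ satisfying $a\wedge\neg a=\bot$, $a\vee\neg a=\top$, and $a\le b\Rightarrow a\vee(\neg a\wedge b)=b$. In it, $a\mathbin{\&}b=(a\vee\neg b)\wedge b$ and $a\rightarrow b=\neg a\vee(a\wedge b)$; $\&$ associates to the left and $a_1\mathbin{\&}\cdots\mathbin{\&}a_n=\top$ when $n=0$. An interpretation is any function $[\![\cdot]\!]:\Phi\to\mathcal Q$ into an orthomodular lattice. A sequent $\phi_1,\ldots,\phi_n\vdash\psi$ is true in it if $[\![\phi_1]\!]\mathbin{\&}\cdots\mathbin{\&}[\![\phi_n]\!]\le[\![\psi]\!]$; a rule of inference is sound if, in every instance, its conclusion is true whenever all its premises are true. -}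

module Defs where

open import Data.List.Base using (List; []; _∷_; _∷ʳ_; foldl; map)
open import Data.List.Relation.Unary.All using (All)
open import Level using (Level; suc; _⊔_)
open import Relation.Binary.Lattice.Bundles using (BoundedLattice)

private
  variable
    p c ℓ₁ ℓ₂ : Level

infix  8 ¬ᶠ_
infixr 7 _∧ᶠ_
infixr 5 _⇒ᶠ_

data Formula (Letter : Set p) : Set p where
  letter : Letter → Formula Letter
  _∧ᶠ_   : Formula Letter → Formula Letter → Formula Letter
  _⇒ᶠ_   : Formula Letter → Formula Letter → Formula Letter
  ¬ᶠ_    : Formula Letter → Formula Letter

infix 3 _⊢_

record Sequent (Letter : Set p) : Set p where
  constructor _⊢_
  field
    antecedent : List (Formula Letter)
    succedent  : Formula Letter

data Rule : Set where
  assumption cut paste compatible-exchange : Rule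
  ∧-intro ∧-elim ⇒-intro ⇒-elim : Rule
  excluded-middle explosion : Rule

-- Instance r premises conclusion: `conclusion` follows from `premises`
-- by one application of r.  Antecedents are read left to right, so the
-- informal "Γ , φ" is Γ ∷ʳ φ.  The rule ∧-elim has two forms.
data Instance {Letter : Set p} :
       Rule → List (Sequent Letter) → Sequent Letter → Set p where

  assumption : ∀ {Γ φ} →
    Instance assumption [] (Γ ∷ʳ φ ⊢ φ)

  cut : ∀ {Γ φ ψ} →
    Instance cut ((Γ ⊢ φ) ∷ (Γ ∷ʳ φ ⊢ ψ) ∷ []) (Γ ⊢ ψ)

  paste : ∀ {Γ φ ψ} →
    Instance paste ((Γ ⊢ φ) ∷ (Γ ⊢ ψ) ∷ []) (Γ ∷ʳ φ ⊢ ψ)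

  compatible-exchange : ∀ {Γ φ ψ χ} →
    Instance compatible-exchange
      ((Γ ∷ʳ φ ∷ʳ ψ ⊢ φ) ∷ (Γ ∷ʳ φ ∷ʳ ψ ⊢ χ) ∷ (Γ ∷ʳ ψ ∷ʳ φ ⊢ ψ) ∷ [])
      (Γ ∷ʳ ψ ∷ʳ φ ⊢ χ)

  ∧-intro : ∀ {Γ φ ψ} →
    Instance ∧-intro ((Γ ⊢ φ) ∷ (Γ ⊢ ψ) ∷ []) (Γ ⊢ φ ∧ᶠ ψ)

  ∧-elimˡ : ∀ {Γ φ ψ} →
    Instance ∧-elim ((Γ ⊢ φ ∧ᶠ ψ) ∷ []) (Γ ⊢ φ)

  ∧-elimʳ : ∀ {Γ φ ψ} →
    Instance ∧-elim ((Γ ⊢ φ ∧ᶠ ψ) ∷ []) (Γ ⊢ ψ)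

  ⇒-intro : ∀ {Γ φ ψ} →
    Instance ⇒-intro ((Γ ∷ʳ φ ⊢ ψ) ∷ []) (Γ ⊢ φ ⇒ᶠ ψ)

  ⇒-elim : ∀ {Γ φ ψ} →
    Instance ⇒-elim ((Γ ⊢ φ ⇒ᶠ ψ) ∷ []) (Γ ∷ʳ φ ⊢ ψ)

  excluded-middle : ∀ {Γ φ ψ} →
    Instance excluded-middle
      ((Γ ∷ʳ φ ⊢ ψ) ∷ (Γ ∷ʳ ¬ᶠ φ ⊢ ψ) ∷ []) (Γ ⊢ ψ)

  explosion : ∀ {Γ φ ψ} →
    Instance explosion ((Γ ⊢ ¬ᶠ φ) ∷ []) (Γ ∷ʳ φ ⊢ ψ)

record OrthomodularLattice c ℓ₁ ℓ₂ : Set (suc (c ⊔ ℓ₁ ⊔ ℓ₂)) where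
  infix  8 ¬_
  infixl 7 _&_
  infixr 5 _⇒_

  field
    boundedLattice : BoundedLattice c ℓ₁ ℓ₂

  open BoundedLattice boundedLattice public

  field
    ¬_            : Carrier → Carrier
    ¬-antitone    : ∀ {a b} → a ≤ b → ¬ b ≤ ¬ a
    ¬-involutive  : ∀ a → ¬ (¬ a) ≈ a
    ∧-complement  : ∀ a → a ∧ ¬ a ≈ ⊥
    ∨-complement  : ∀ a → a ∨ ¬ a ≈ ⊤
    orthomodular  : ∀ {a b} → a ≤ b → a ∨ (¬ a ∧ b) ≈ b

  -- The Sasaki projection; neither commutative nor associative in general.
  _&_ : Carrier → Carrier → Carrier
  a & b = (a ∨ ¬ b) ∧ b

  -- The Sasaki arrow.
  _⇒_ : Carrier → Carrier → Carrier
  a ⇒ b = ¬ a ∨ (a ∧ b)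

  ⋀& : List Carrier → Carrier
  ⋀& []       = ⊤
  ⋀& (a ∷ as) = foldl _&_ a as

module _ {Letter : Set p} (Q : OrthomodularLattice c ℓ₁ ℓ₂)
         (⟦_⟧ : Formula Letter → OrthomodularLattice.Carrier Q) where

  open OrthomodularLattice Q

  True : Sequent Letter → Set ℓ₂
  True (Γ ⊢ ψ) = ⋀& (map ⟦_⟧ Γ) ≤ ⟦ ψ ⟧

  Sound : Rule → Set (p ⊔ ℓ₂)
  Sound r = ∀ {premises conclusion} → Instance r premises conclusion →
            All True premises → True conclusion

{-# OPTIONS --safe #-}
-- Sasaki projection x ↦ x & a is left adjoint to the Sasaki arrow a ⇒_, and it
-- fixes every element below a.  With these two facts the rules other than
-- compatible exchange and excluded middle are immediate.  For compatible
-- exchange, projecting onto a and then onto some m ≤ a is the same as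
-- projecting onto m; the first and third premises place both (g & a) & b and
-- (g & b) & a below a ∧ b, so both equal g & (a ∧ b).
module Submission where

open import Data.List.Base using (List; []; _∷_; _∷ʳ_; map)
open import Data.List.Properties using (foldl-∷ʳ; map-++)
open import Data.List.Relation.Unary.All using ([]; _∷_)
open import Relation.Binary.PropositionalEquality using (cong)
import Relation.Binary.Lattice.Properties.JoinSemilattice as JoinProperties
import Relation.Binary.Lattice.Properties.MeetSemilattice as MeetProperties
import Relation.Binary.Reasoning.PartialOrder as PosetReasoning

open import Defs

module OrthomodularProperties {c ℓ₁ ℓ₂} (Q : OrthomodularLattice c ℓ₁ ℓ₂) where

  open OrthomodularLattice Q
  open JoinProperties joinSemilattice using (∨-monotonic)
  open MeetProperties meetSemilattice using (∧-monotonic)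
  open PosetReasoning poset

  ¬¬-≤ : ∀ {a} → ¬ (¬ a) ≤ a
  ¬¬-≤ {a} = reflexive (¬-involutive a)

  ≤-¬¬ : ∀ {a} → a ≤ ¬ (¬ a)
  ≤-¬¬ {a} = reflexive (Eq.sym (¬-involutive a))

  ¬-flip : ∀ {a b} → a ≤ ¬ b → b ≤ ¬ a
  ¬-flip a≤¬b = trans ≤-¬¬ (¬-antitone a≤¬b)

  &-≤ʳ : ∀ {x a} → x & a ≤ a
  &-≤ʳ = x∧y≤y _ _

  &-monoˡ : ∀ {x y a} → x ≤ y → x & a ≤ y & a
  &-monoˡ x≤y = ∧-monotonic (∨-monotonic x≤y refl) refl

  &-congˡ : ∀ {x y a} → x ≈ y → x & a ≈ y & a
  &-congˡ x≈y = antisym (&-monoˡ (reflexive x≈y)) (&-monoˡ (reflexive (Eq.sym x≈y)))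

  ⊤-&ˡ : ∀ a → ⊤ & a ≈ a
  ⊤-&ˡ a = antisym &-≤ʳ (∧-greatest (trans (maximum a) (x≤x∨y _ _)) refl)

  -- The orthomodular law rebuilds `b` from `a` and the difference, which here contributes nothing.
  difference-⊥⇒≥ : ∀ {a b} → a ≤ b → ¬ a ∧ b ≤ ⊥ → b ≤ a
  difference-⊥⇒≥ {a} {b} a≤b d≤⊥ = begin
    b              ≈⟨ orthomodular a≤b ⟨
    a ∨ (¬ a ∧ b)  ≤⟨ ∨-least refl (trans d≤⊥ (minimum a)) ⟩
    a              ∎

  -- The order dual of the orthomodular law.
  x≤a⇒x&a≈x : ∀ {x a} → x ≤ a → x & a ≈ x
  x≤a⇒x&a≈x {x} {a} x≤a = antisym &≤x (∧-greatest (x≤x∨y _ _) x≤a)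
    where
    x∨¬a≤ : x ∨ ¬ a ≤ ¬ (¬ (¬ a) ∧ ¬ x)
    x∨¬a≤ = ∨-least (¬-flip (x∧y≤y _ _)) (¬-flip (x∧y≤x _ _))

    ¬x≤ : ¬ x ≤ ¬ (x & a)
    ¬x≤ = begin
      ¬ x                      ≈⟨ orthomodular (¬-antitone x≤a) ⟨
      ¬ a ∨ (¬ (¬ a) ∧ ¬ x)    ≤⟨ ∨-least (¬-antitone &-≤ʳ) (¬-flip (trans (x∧y≤x _ _) x∨¬a≤)) ⟩
      ¬ (x & a)                ∎

    &≤x : x & a ≤ x
    &≤x = trans (¬-flip ¬x≤) ¬¬-≤

  -- The orthomodular law for `¬ a ≤ x ∨ ¬ a` leaves the remainder `¬ (¬ a) ∧ (x ∨ ¬ a)`, which is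
  -- `x & a`. Thus projecting onto `a` loses nothing modulo `¬ a`.
  x∨¬a≤x&a∨¬a : ∀ {x a} → x ∨ ¬ a ≤ (x & a) ∨ ¬ a
  x∨¬a≤x&a∨¬a {x} {a} = begin
    x ∨ ¬ a                          ≈⟨ orthomodular (y≤x∨y x (¬ a)) ⟨
    ¬ a ∨ (¬ (¬ a) ∧ (x ∨ ¬ a))      ≤⟨ ∨-least (y≤x∨y _ _) (trans
                                          (∧-greatest (x∧y≤y _ _) (trans (x∧y≤x _ _) ¬¬-≤))
                                          (x≤x∨y _ _)) ⟩
    (x & a) ∨ ¬ a                    ∎

  &-≤⇒≤-⇒ : ∀ {x a b} → x & a ≤ b → x ≤ a ⇒ b
  &-≤⇒≤-⇒ {x} {a} {b} x&a≤b = begin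
    x              ≤⟨ x≤x∨y _ _ ⟩
    x ∨ ¬ a        ≤⟨ x∨¬a≤x&a∨¬a ⟩
    (x & a) ∨ ¬ a  ≤⟨ ∨-least (trans (∧-greatest &-≤ʳ x&a≤b) (y≤x∨y _ _)) (x≤x∨y _ _) ⟩
    a ⇒ b          ∎

  ≤-⇒⇒&-≤ : ∀ {x a b} → x ≤ a ⇒ b → x & a ≤ b
  ≤-⇒⇒&-≤ {x} {a} {b} x≤a⇒b = begin
    -- Up to order of the joinands `a ⇒ b` is `(a ∧ b) ∨ ¬ a`, so the bound on `x` passes to
    -- `x ∨ ¬ a`.
    x & a        ≤⟨ ∧-monotonic (∨-least (trans x≤a⇒b (∨-least (y≤x∨y _ _) (x≤x∨y _ _)))
                                         (y≤x∨y _ _)) refl ⟩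
    (a ∧ b) & a  ≈⟨ x≤a⇒x&a≈x (x∧y≤x a b) ⟩
    a ∧ b        ≤⟨ x∧y≤y a b ⟩
    b            ∎

  -- Projection onto `m` depends only on the join with `¬ m`. Since `¬ a ≤ ¬ m`, and `x` and `x & a`
  -- have the same join with `¬ a`, they also have the same join with `¬ m`.
  &-absorb : ∀ {x a m} → m ≤ a → (x & a) & m ≈ x & m
  &-absorb {x} {a} {m} m≤a = antisym
    (∧-monotonic (∨-least
      (trans (x∧y≤x _ _) (∨-monotonic refl ¬a≤¬m)) (y≤x∨y _ _)) refl)
    (∧-monotonic (∨-least
      (trans (x≤x∨y x (¬ a)) (trans x∨¬a≤x&a∨¬a (∨-monotonic refl ¬a≤¬m)))
      (y≤x∨y _ _)) refl)
    where
    ¬a≤¬m : ¬ a ≤ ¬ m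
    ¬a≤¬m = ¬-antitone m≤a

  -- Projecting onto `m` fixes `x & a & b`; once that projection is appended, it absorbs first `b`
  -- and then `a`.
  x&a&b≤m⇒x&a&b≈x&m : ∀ {x a b m} → m ≤ a → m ≤ b → x & a & b ≤ m → x & a & b ≈ x & m
  x&a&b≤m⇒x&a&b≈x&m {x} {a} {b} {m} m≤a m≤b ≤m = begin-equality
    x & a & b      ≈⟨ x≤a⇒x&a≈x ≤m ⟨
    x & a & b & m  ≈⟨ &-absorb m≤b ⟩
    x & a & m      ≈⟨ &-absorb m≤a ⟩
    x & m          ∎

  &-exchange : ∀ {x a b} → x & a & b ≤ a → x & b & a ≤ b → x & b & a ≈ x & a & b
  &-exchange {x} {a} {b} xab≤a xba≤b = begin-equality
    x & b & a    ≈⟨ x&a&b≤m⇒x&a&b≈x&m (x∧y≤y a b) (x∧y≤x a b) (∧-greatest &-≤ʳ xba≤b) ⟩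
    x & (a ∧ b)  ≈⟨ x&a&b≤m⇒x&a&b≈x&m (x∧y≤x a b) (x∧y≤y a b) (∧-greatest xab≤a &-≤ʳ) ⟨
    x & a & b    ∎

  -- By adjointness x lies below e = (¬ a ∨ p) ∧ (a ∨ q) with p = a ∧ b and
  -- q = ¬ a ∧ b.  Removing p from ¬ a ∨ p leaves ¬ a and removing q from
  -- a ∨ q leaves a, so e exceeds p ∨ q by at most ¬ a ∧ a.
  &-cases : ∀ {x a b} → x & a ≤ b → x & ¬ a ≤ b → x ≤ b
  &-cases {x} {a} {b} xa≤b x¬a≤b = begin
    x      ≤⟨ ∧-greatest x≤¬a∨p x≤a∨q ⟩
    e      ≤⟨ difference-⊥⇒≥ p∨q≤e excess≤⊥ ⟩
    p ∨ q  ≤⟨ ∨-least (x∧y≤y _ _) (x∧y≤y _ _) ⟩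
    b      ∎
    where
    p = a ∧ b
    q = ¬ a ∧ b
    e = (¬ a ∨ p) ∧ (a ∨ q)

    x≤¬a∨p : x ≤ ¬ a ∨ p
    x≤¬a∨p = &-≤⇒≤-⇒ xa≤b

    x≤a∨q : x ≤ a ∨ q
    x≤a∨q = trans (&-≤⇒≤-⇒ x¬a≤b) (∨-monotonic ¬¬-≤ refl)

    p∨q≤e : p ∨ q ≤ e
    p∨q≤e = ∨-least
      (∧-greatest (y≤x∨y _ _) (trans (x∧y≤x _ _) (x≤x∨y _ _)))
      (∧-greatest (trans (x∧y≤x _ _) (x≤x∨y _ _)) (y≤x∨y _ _))

    -- Up to a double negation the left side is `u & ¬ v`, and projection onto `¬ v` fixes `u`.
    remove : ∀ {u v} → u ≤ ¬ v → (u ∨ v) ∧ ¬ v ≤ u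
    remove u≤¬v = trans (∧-monotonic (∨-monotonic refl ≤-¬¬) refl)
                        (reflexive (x≤a⇒x&a≈x u≤¬v))

    excess≤⊥ : ¬ (p ∨ q) ∧ e ≤ ⊥
    excess≤⊥ = begin
      ¬ (p ∨ q) ∧ e  ≤⟨ ∧-greatest
        (trans (∧-greatest (trans (x∧y≤y _ _) (x∧y≤y _ _))
                           (trans (x∧y≤x _ _) (¬-antitone (y≤x∨y _ _))))
               (remove (¬-flip (x∧y≤x _ _))))
        (trans (∧-greatest (trans (x∧y≤y _ _) (x∧y≤x _ _))
                           (trans (x∧y≤x _ _) (¬-antitone (x≤x∨y _ _))))
               (remove (¬-antitone (x∧y≤x _ _)))) ⟩
      a ∧ ¬ a        ≈⟨ ∧-complement a ⟩
      ⊥              ∎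

  &-explosion : ∀ {x a b} → x ≤ ¬ a → x & a ≤ b
  &-explosion {x} {a} {b} x≤¬a = begin
    (x ∨ ¬ a) ∧ a  ≤⟨ ∧-greatest (x∧y≤y _ _) (trans (x∧y≤x _ _) (∨-least x≤¬a refl)) ⟩
    a ∧ ¬ a        ≈⟨ ∧-complement a ⟩
    ⊥              ≤⟨ minimum b ⟩
    b              ∎

  -- `⋀&` folds from the first entry and not from `⊤`, so the empty list needs `⊤` to be a left
  -- unit.
  ⋀&-∷ʳ : ∀ as a → ⋀& (as ∷ʳ a) ≈ ⋀& as & a
  ⋀&-∷ʳ []       a = Eq.sym (⊤-&ˡ a)
  ⋀&-∷ʳ (b ∷ bs) a = Eq.reflexive (foldl-∷ʳ _&_ b a bs)

theorem3p5 : ∀ {p c ℓ₁ ℓ₂} {Letter : Set p} (Q : OrthomodularLattice c ℓ₁ ℓ₂) →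
    let open OrthomodularLattice Q in
    (⟦_⟧ : Formula Letter → Carrier) →
    (∀ φ ψ → ⟦ φ ∧ᶠ ψ ⟧ ≈ ⟦ φ ⟧ ∧ ⟦ ψ ⟧) →
    (∀ φ ψ → ⟦ φ ⇒ᶠ ψ ⟧ ≈ (⟦ φ ⟧ ⇒ ⟦ ψ ⟧)) →
    (∀ φ → ⟦ ¬ᶠ φ ⟧ ≈ ¬ ⟦ φ ⟧) →
    ∀ (r : Rule) → Sound Q ⟦_⟧ r
theorem3p5 {Letter = Letter} Q ⟦_⟧ ⟦∧⟧ ⟦⇒⟧ ⟦¬⟧ _ = sound
  where
  open OrthomodularLattice Q
  open OrthomodularProperties Q
  open MeetProperties meetSemilattice using (∧-monotonic)
  open JoinProperties joinSemilattice using (∨-monotonic)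

  ⟦_⟧* : List (Formula Letter) → Carrier
  ⟦ Γ ⟧* = ⋀& (map ⟦_⟧ Γ)

  snoc : ∀ Γ φ → ⟦ Γ ∷ʳ φ ⟧* ≈ ⟦ Γ ⟧* & ⟦ φ ⟧
  snoc Γ φ = Eq.trans (Eq.reflexive (cong ⋀& (map-++ ⟦_⟧ Γ (φ ∷ []))))
                      (⋀&-∷ʳ (map ⟦_⟧ Γ) ⟦ φ ⟧)

  snoc₂ : ∀ Γ φ ψ → ⟦ Γ ∷ʳ φ ∷ʳ ψ ⟧* ≈ ⟦ Γ ⟧* & ⟦ φ ⟧ & ⟦ ψ ⟧
  snoc₂ Γ φ ψ = Eq.trans (snoc (Γ ∷ʳ φ) ψ) (&-congˡ (snoc Γ φ))

  ≈-≤ : ∀ {x y z} → x ≈ y → y ≤ z → x ≤ z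
  ≈-≤ x≈y = trans (reflexive x≈y)

  ≈˘-≤ : ∀ {x y z} → y ≈ x → y ≤ z → x ≤ z
  ≈˘-≤ y≈x = ≈-≤ (Eq.sym y≈x)

  sound : ∀ {r} → Sound Q ⟦_⟧ r
  sound (assumption {Γ} {φ}) [] = ≈-≤ (snoc Γ φ) &-≤ʳ
  -- For cut and paste alike, `Γ ⊢ φ` puts the value of `Γ` below that of `φ`, so appending `φ`
  -- leaves it unchanged.
  sound (cut {Γ} {φ}) (Γ⊢φ ∷ Γφ⊢ψ ∷ []) =
    ≈˘-≤ (x≤a⇒x&a≈x Γ⊢φ) (≈˘-≤ (snoc Γ φ) Γφ⊢ψ)
  sound (paste {Γ} {φ}) (Γ⊢φ ∷ Γ⊢ψ ∷ []) =
    ≈-≤ (snoc Γ φ) (≈-≤ (x≤a⇒x&a≈x Γ⊢φ) Γ⊢ψ)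
  sound (compatible-exchange {Γ} {φ} {ψ}) (Γφψ⊢φ ∷ Γφψ⊢χ ∷ Γψφ⊢ψ ∷ []) =
    ≈-≤ (snoc₂ Γ ψ φ)
      (≈-≤ (&-exchange (≈˘-≤ (snoc₂ Γ φ ψ) Γφψ⊢φ) (≈˘-≤ (snoc₂ Γ ψ φ) Γψφ⊢ψ))
        (≈˘-≤ (snoc₂ Γ φ ψ) Γφψ⊢χ))
  sound (∧-intro {φ = φ} {ψ}) (Γ⊢φ ∷ Γ⊢ψ ∷ []) =
    trans (∧-greatest Γ⊢φ Γ⊢ψ) (reflexive (Eq.sym (⟦∧⟧ φ ψ)))
  sound (∧-elimˡ {φ = φ} {ψ}) (Γ⊢φ∧ψ ∷ []) =
    trans Γ⊢φ∧ψ (≈-≤ (⟦∧⟧ φ ψ) (x∧y≤x _ _))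
  sound (∧-elimʳ {φ = φ} {ψ}) (Γ⊢φ∧ψ ∷ []) =
    trans Γ⊢φ∧ψ (≈-≤ (⟦∧⟧ φ ψ) (x∧y≤y _ _))
  sound (⇒-intro {Γ} {φ} {ψ}) (Γφ⊢ψ ∷ []) =
    trans (&-≤⇒≤-⇒ (≈˘-≤ (snoc Γ φ) Γφ⊢ψ)) (reflexive (Eq.sym (⟦⇒⟧ φ ψ)))
  sound (⇒-elim {Γ} {φ} {ψ}) (Γ⊢φ⇒ψ ∷ []) =
    ≈-≤ (snoc Γ φ) (≤-⇒⇒&-≤ (trans Γ⊢φ⇒ψ (reflexive (⟦⇒⟧ φ ψ))))
  sound (excluded-middle {Γ} {φ}) (Γφ⊢ψ ∷ Γ¬φ⊢ψ ∷ []) =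
    &-cases (≈˘-≤ (snoc Γ φ) Γφ⊢ψ)
            (trans &-¬-≤ (≈˘-≤ (snoc Γ (¬ᶠ φ)) Γ¬φ⊢ψ))
    where
    -- The right argument of `&` occurs both plainly and negated, so both directions of `⟦¬⟧ φ`
    -- enter.
    &-¬-≤ : ⟦ Γ ⟧* & ¬ ⟦ φ ⟧ ≤ ⟦ Γ ⟧* & ⟦ ¬ᶠ φ ⟧
    &-¬-≤ = ∧-monotonic (∨-monotonic refl (¬-antitone (reflexive (⟦¬⟧ φ))))
                        (reflexive (Eq.sym (⟦¬⟧ φ)))
  sound (explosion {Γ} {φ}) (Γ⊢¬φ ∷ []) =
    ≈-≤ (snoc Γ φ) (&-explosion (trans Γ⊢¬φ (reflexive (⟦¬⟧ φ))))
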